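{- For every formula $A$ of $\mathsf{IL}^\omega$, $(|A^{\circ}|^{\mathbf x} \multimap (\mathbf x \,\mathsf{mr}\, A)^{\circ}) \,\&\, ((\mathbf x \,\mathsf{mr}\, A)^{\circ} \multimap |A^{\circ}|^{\mathbf x})$ is provable, where $\mathbf x \,\mathsf{mr}\, A$ is Kreisel's modified realizability.
   Context: The translation $A^{\circ}$ of $\mathsf{IL}^\omega$ into intuitionistic linear logic is: $A_{\mathrm{at}}^{\circ} :\equiv \mathord{!}A_{\mathrm{at}}$ ($A_{\mathrm{at}}\not\equiv\bot$); $\bot^{\circ}:\equiv 0$; $(A\wedge B)^{\circ}:\equiv A^{\circ}\otimes B^{\circ}$; $(A\vee B)^{\circ}:\equiv A^{\circ}\oplus B^{\circ}$; $(A\to B)^{\circ}:\equiv\mathord{!}(A^{\circ}\multimap B^{\circ})$; $(\forall xA)^{\circ}:\equiv\mathord{!}\forall xA^{\circ}$; $(\exists xA)^{\circ}:\equiv\exists xA^{\circ}$. The verifying system $\mathsf{ILL}^\omega_b$ is intuitionistic linear logic over finite types plus booleans $\mathsf{T},\mathsf{F}$, equality $=^b$, conditional terms, and axioms ensuring $\mathsf{T}\ne\mathsf{F}$ and every boolean is $\mathsf{T}$ or $\mathsf{F}$; $\mathrm{cond}_z(A,B) :\equiv (\mathord{!}(z=^b\mathsf{T}) \multimap A) \,\&\, (\mathord{!}(z=^b\mathsf{F}) \multimap B)$. The interpretation: $|A_{\mathrm{at}}|:\equiv A_{\mathrm{at}}$; $|A \multimap B|^{\mathbf f,\mathbf g}_{\mathbf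 x,\mathbf w} :\equiv |A|^{\mathbf x}_{\mathbf f\mathbf x\mathbf w} \multimap |B|^{\mathbf g\mathbf x}_{\mathbf w}$; $|A\otimes B|^{\mathbf x,\mathbf v}_{\mathbf y,\mathbf w} :\equiv |A|^{\mathbf x}_{\mathbf y}\otimes|B|^{\mathbf v}_{\mathbf w}$; $|A\,\&\,B|^{\mathbf x,\mathbf v}_{\mathbf y,\mathbf w} :\equiv |A|^{\mathbf x}_{\mathbf y}\,\&\,|B|^{\mathbf v}_{\mathbf w}$; $|A\oplus B|^{\mathbf x,\mathbf v,z}_{\mathbf y,\mathbf w} :\equiv \mathrm{cond}_z(|A|^{\mathbf x}_{\mathbf y},|B|^{\mathbf v}_{\mathbf w})$; $|\exists z A(z)|^{\mathbf x,z}_{\mathbf y} :\equiv |A(z)|^{\mathbf x}_{\mathbf y}$; $|\forall z A(z)|^{\mathbf f}_{\mathbf y,z} :\equiv |A(z)|^{\mathbf f z}_{\mathbf y}$; $|\mathord{!}A|^{\mathbf x} :\equiv \mathord{!}\,\forall \mathbf y\,|A|^{\mathbf x}_{\mathbf y}$ (no challenges, so $A^{\circ}$ is interpreted with no challenges). Modified realizability of disjunction uses a boolean: $\mathbf x,\mathbf y,z \,\mathsf{mr}\, (A\vee B) \equiv (z=\mathsf{T}\to\mathbf x\,\mathsf{mr}\,A)\wedge(z=\mathsf{F}\to\mathbf y\,\mathsf{mr}\,B)$. -}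

module Defs where

open import Data.List using (List; []; _∷_; _++_; map; [_])
open import Data.List.Relation.Binary.Permutation.Propositional using (_↭_)
open import Relation.Binary.PropositionalEquality using (_≡_; refl; cong; cong₂; subst)

infixr 7 _⇒_
data Ty : Set where
  ι   : Ty                 -- natural numbers (type 0)
  𝔹   : Ty
  _⇒_ : Ty → Ty → Ty

Ctx : Set
Ctx = List Ty

infix 4 _∋_
data _∋_ : Ctx → Ty → Set where
  here  : ∀ {Γ σ} → (σ ∷ Γ) ∋ σ
  there : ∀ {Γ σ τ} → Γ ∋ σ → (τ ∷ Γ) ∋ σ

infixr 7 _⇒*_
_⇒*_ : List Ty → Ty → Ty
[] ⇒* ρ = ρ
(σ ∷ Δ) ⇒* ρ = σ ⇒ (Δ ⇒* ρ)

data Tm (Γ : Ctx) : Ty → Set where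
  var  : ∀ {σ} → Γ ∋ σ → Tm Γ σ
  lam  : ∀ {σ τ} → Tm (σ ∷ Γ) τ → Tm Γ (σ ⇒ τ)
  app  : ∀ {σ τ} → Tm Γ (σ ⇒ τ) → Tm Γ σ → Tm Γ τ
  𝟎    : Tm Γ ι
  𝐒    : Tm Γ ι → Tm Γ ι
  Rec  : ∀ {σ} → Tm Γ σ → Tm Γ (ι ⇒ σ ⇒ σ) → Tm Γ ι → Tm Γ σ
  𝐓    : Tm Γ 𝔹
  𝐅    : Tm Γ 𝔹
  Cond : ∀ {σ} → Tm Γ 𝔹 → Tm Γ σ → Tm Γ σ → Tm Γ σ

Ren : Ctx → Ctx → Set
Ren Δ Γ = ∀ {σ} → Γ ∋ σ → Δ ∋ σ

liftR : ∀ {Δ Γ σ} → Ren Δ Γ → Ren (σ ∷ Δ) (σ ∷ Γ)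
liftR r here      = here
liftR r (there v) = there (r v)

ren : ∀ {Δ Γ σ} → Ren Δ Γ → Tm Γ σ → Tm Δ σ
ren r (var v)      = var (r v)
ren r (lam t)      = lam (ren (liftR r) t)
ren r (app t s)    = app (ren r t) (ren r s)
ren r 𝟎            = 𝟎
ren r (𝐒 t)        = 𝐒 (ren r t)
ren r (Rec z f n)  = Rec (ren r z) (ren r f) (ren r n)
ren r 𝐓            = 𝐓
ren r 𝐅            = 𝐅
ren r (Cond b s t) = Cond (ren r b) (ren r s) (ren r t)

Sub : Ctx → Ctx → Set
Sub Δ Γ = ∀ {σ} → Γ ∋ σ → Tm Δ σ

liftS : ∀ {Δ Γ σ} → Sub Δ Γ → Sub (σ ∷ Δ) (σ ∷ Γ)
liftS s here      = var here
liftS s (there v) = ren there (s v)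

sub : ∀ {Δ Γ σ} → Sub Δ Γ → Tm Γ σ → Tm Δ σ
sub s (var v)      = s v
sub s (lam t)      = lam (sub (liftS s) t)
sub s (app t u)    = app (sub s t) (sub s u)
sub s 𝟎            = 𝟎
sub s (𝐒 t)        = 𝐒 (sub s t)
sub s (Rec z f n)  = Rec (sub s z) (sub s f) (sub s n)
sub s 𝐓            = 𝐓
sub s 𝐅            = 𝐅
sub s (Cond b t u) = Cond (sub s b) (sub s t) (sub s u)

infixr 5 _∷ˢ_
_∷ˢ_ : ∀ {Θ Γ σ} → Tm Θ σ → Sub Θ Γ → Sub Θ (σ ∷ Γ)
(t ∷ˢ s) here      = t
(t ∷ˢ s) (there v) = s v

inl : ∀ {Δ Γ σ} → Δ ∋ σ → (Δ ++ Γ) ∋ σ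
inl here      = here
inl (there v) = there (inl v)

inr : ∀ (Δ : Ctx) {Γ σ} → Γ ∋ σ → (Δ ++ Γ) ∋ σ
inr []      v = v
inr (τ ∷ Δ) v = there (inr Δ v)

split : ∀ (Δ : Ctx) {Θ Γ} → Sub Θ Δ → Sub Θ Γ → Sub Θ (Δ ++ Γ)
split []      s t v         = t v
split (σ ∷ Δ) s t here      = s here
split (σ ∷ Δ) s t (there v) = split Δ (λ w → s (there w)) t v

mapVar : ∀ (f : Ty → Ty) {Δ σ} → Δ ∋ σ → map f Δ ∋ f σ
mapVar f here      = here
mapVar f (there v) = there (mapVar f v)

apps : ∀ (Δ : Ctx) {Θ ρ} → Tm Θ (Δ ⇒* ρ) → Sub Θ Δ → Tm Θ ρ
apps []      t s = t
apps (σ ∷ Δ) t s = apps Δ (app t (s here)) (λ v → s (there v))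

infix 6 _≐_
data Atom (Γ : Ctx) : Set where
  _≐_ : ∀ {σ} → Tm Γ σ → Tm Γ σ → Atom Γ

subA : ∀ {Δ Γ} → Sub Δ Γ → Atom Γ → Atom Δ
subA s (t ≐ u) = sub s t ≐ sub s u

infixr 6 _∧_
infixr 5 _∨_
infixr 4 _⇛_
data Fm (Γ : Ctx) : Set where
  atm : Atom Γ → Fm Γ
  ⊥ᶠ  : Fm Γ
  _∧_ : Fm Γ → Fm Γ → Fm Γ
  _∨_ : Fm Γ → Fm Γ → Fm Γ
  _⇛_ : Fm Γ → Fm Γ → Fm Γ
  Al  : (σ : Ty) → Fm (σ ∷ Γ) → Fm Γ
  Ex  : (σ : Ty) → Fm (σ ∷ Γ) → Fm Γ

subF : ∀ {Δ Γ} → Sub Δ Γ → Fm Γ → Fm Δ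
subF s (atm a)  = atm (subA s a)
subF s ⊥ᶠ       = ⊥ᶠ
subF s (A ∧ B)  = subF s A ∧ subF s B
subF s (A ∨ B)  = subF s A ∨ subF s B
subF s (A ⇛ B)  = subF s A ⇛ subF s B
subF s (Al σ A) = Al σ (subF (liftS s) A)
subF s (Ex σ A) = Ex σ (subF (liftS s) A)

Al* : ∀ (Δ : Ctx) {Γ} → Fm (Δ ++ Γ) → Fm Γ
Al* []      A = A
Al* (σ ∷ Δ) A = Al* Δ (Al σ A)

infixr 8 _⊗_
infixr 8 _&_
infixr 7 _⊕_
infixr 6 _⊸_
infix 9 !_
data LFm (Γ : Ctx) : Set where
  atm  : Atom Γ → LFm Γ
  𝟘    : LFm Γ
  _⊗_  : LFm Γ → LFm Γ → LFm Γ
  _&_  : LFm Γ → LFm Γ → LFm Γ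
  _⊕_  : LFm Γ → LFm Γ → LFm Γ
  _⊸_  : LFm Γ → LFm Γ → LFm Γ
  !_   : LFm Γ → LFm Γ
  Alₗ  : (σ : Ty) → LFm (σ ∷ Γ) → LFm Γ
  Exₗ  : (σ : Ty) → LFm (σ ∷ Γ) → LFm Γ

subL : ∀ {Δ Γ} → Sub Δ Γ → LFm Γ → LFm Δ
subL s (atm a)   = atm (subA s a)
subL s 𝟘         = 𝟘
subL s (A ⊗ B)   = subL s A ⊗ subL s B
subL s (A & B)   = subL s A & subL s B
subL s (A ⊕ B)   = subL s A ⊕ subL s B
subL s (A ⊸ B)   = subL s A ⊸ subL s B
subL s (! A)     = ! subL s A
subL s (Alₗ σ A) = Alₗ σ (subL (liftS s) A)
subL s (Exₗ σ A) = Exₗ σ (subL (liftS s) A)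

wkL : ∀ {Γ σ} → LFm Γ → LFm (σ ∷ Γ)
wkL = subL (λ v → var (there v))

_[_]ₗ : ∀ {Γ σ} → LFm (σ ∷ Γ) → Tm Γ σ → LFm Γ
A [ t ]ₗ = subL (t ∷ˢ var) A

Alₗ* : ∀ (Δ : Ctx) {Γ} → LFm (Δ ++ Γ) → LFm Γ
Alₗ* []      A = A
Alₗ* (σ ∷ Δ) A = Alₗ* Δ (Alₗ σ A)

infix 10 _°
_° : ∀ {Γ} → Fm Γ → LFm Γ
atm a °    = ! atm a
⊥ᶠ °       = 𝟘
(A ∧ B) °  = A ° ⊗ B °
(A ∨ B) °  = A ° ⊕ B °
(A ⇛ B) °  = ! (A ° ⊸ B °)
Al σ A °   = ! Alₗ σ (A °)
Ex σ A °   = Exₗ σ (A °)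

-- Kreisel's modified realizability:  𝐱 mr A  is  mr A , a formula whose
-- first free variables 𝐱 have the types τ A  (booleans for disjunction)

τ : ∀ {Γ} → Fm Γ → List Ty
τ (atm a)  = []
τ ⊥ᶠ       = []
τ (A ∧ B)  = τ A ++ τ B
τ (A ∨ B)  = τ A ++ τ B ++ [ 𝔹 ]
τ (A ⇛ B)  = map (τ A ⇒*_) (τ B)
τ (Al σ A) = map (σ ⇒_) (τ A)
τ (Ex σ A) = τ A ++ [ σ ]

mr : ∀ {Γ} (A : Fm Γ) → Fm (τ A ++ Γ)
mr (atm a) = atm a
mr ⊥ᶠ      = ⊥ᶠ
mr {Γ} (A ∧ B) =
  subF (split (τ A) (λ v → var (inl (inl v))) (λ v → var (inr (τ A ++ τ B) v))) (mr A)
  ∧ subF (split (τ B) (λ v → var (inl (inr (τ A) v))) (λ v → var (inr (τ A ++ τ B) v))) (mr B)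
mr {Γ} (A ∨ B) =
  (atm (z ≐ 𝐓) ⇛ subF (split (τ A) a g) (mr A))
  ∧ (atm (z ≐ 𝐅) ⇛ subF (split (τ B) b g) (mr B))
  where
    X = τ A ++ τ B ++ [ 𝔹 ]
    a : Sub (X ++ Γ) (τ A)
    a v = var (inl (inl v))
    b : Sub (X ++ Γ) (τ B)
    b v = var (inl (inr (τ A) (inl v)))
    z : Tm (X ++ Γ) 𝔹
    z = var (inl (inr (τ A) (inr (τ B) here)))
    g : Sub (X ++ Γ) Γ
    g v = var (inr X v)
mr {Γ} (A ⇛ B) =
  Al* (τ A)
    (subF (split (τ A) xs gs) (mr A)
     ⇛ subF (split (τ B) fx gs) (mr B))
  where
    X = map (τ A ⇒*_) (τ B)
    xs : Sub (τ A ++ X ++ Γ) (τ A)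
    xs v = var (inl v)
    gs : Sub (τ A ++ X ++ Γ) Γ
    gs v = var (inr (τ A) (inr X v))
    fx : Sub (τ A ++ X ++ Γ) (τ B)
    fx v = apps (τ A) (var (inr (τ A) (inl (mapVar (τ A ⇒*_) v)))) xs
mr {Γ} (Al σ A) =
  Al σ (subF (split (τ A) fz (var here ∷ˢ gs)) (mr A))
  where
    X = map (σ ⇒_) (τ A)
    fz : Sub (σ ∷ X ++ Γ) (τ A)
    fz v = app (var (there (inl (mapVar (σ ⇒_) v)))) (var here)
    gs : Sub (σ ∷ X ++ Γ) Γ
    gs v = var (there (inr X v))
mr {Γ} (Ex σ A) =
  subF (split (τ A) (λ v → var (inl (inl v)))
                    (var (inl (inr (τ A) here)) ∷ˢ (λ v → var (inr (τ A ++ [ σ ]) v))))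
       (mr A)

-- The functional interpretation of linear logic:
--   ⟦ A ⟧ is |A|^𝐱_𝐲 , a formula whose first free variables are the
--   challenges 𝐲 (types C A) followed by the witnesses 𝐱 (types W A).

arrTy : List Ty → List Ty → Ty → Ty
arrTy Δ Θ ρ = Δ ⇒* (Θ ⇒* ρ)

W C : ∀ {Γ} → LFm Γ → List Ty
W (atm a)   = []
W 𝟘         = []
W (A ⊗ B)   = W A ++ W B
W (A & B)   = W A ++ W B
W (A ⊕ B)   = W A ++ W B ++ [ 𝔹 ]
W (A ⊸ B)   = map (arrTy (W A) (C B)) (C A) ++ map (W A ⇒*_) (W B)
W (! A)     = W A
W (Alₗ σ A) = map (σ ⇒_) (W A)
W (Exₗ σ A) = W A ++ [ σ ]
C (atm a)   = []
C 𝟘         = []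
C (A ⊗ B)   = C A ++ C B
C (A & B)   = C A ++ C B
C (A ⊕ B)   = C A ++ C B
C (A ⊸ B)   = W A ++ C B
C (! A)     = []
C (Alₗ σ A) = C A ++ [ σ ]
C (Exₗ σ A) = C A

condₗ : ∀ {Γ} → Tm Γ 𝔹 → LFm Γ → LFm Γ → LFm Γ
condₗ z A B = (! atm (z ≐ 𝐓) ⊸ A) & (! atm (z ≐ 𝐅) ⊸ B)

module _ {Γ : Ctx} (X : LFm Γ) where
  cv : Sub (C X ++ W X ++ Γ) (C X)
  cv v = var (inl v)
  wv : Sub (C X ++ W X ++ Γ) (W X)
  wv v = var (inr (C X) (inl v))
  gv : Sub (C X ++ W X ++ Γ) Γ
  gv v = var (inr (C X) (inr (W X) v))

⟦_⟧ : ∀ {Γ} (A : LFm Γ) → LFm (C A ++ W A ++ Γ)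
⟦ atm a ⟧ = atm a
⟦ 𝟘 ⟧     = 𝟘
⟦ A ⊗ B ⟧ =
  subL (split (C A) (λ v → cv (A ⊗ B) (inl v)) (split (W A) (λ v → wv (A ⊗ B) (inl v)) (gv (A ⊗ B)))) ⟦ A ⟧
  ⊗ subL (split (C B) (λ v → cv (A ⊗ B) (inr (C A) v)) (split (W B) (λ v → wv (A ⊗ B) (inr (W A) v)) (gv (A ⊗ B)))) ⟦ B ⟧
⟦ A & B ⟧ =
  subL (split (C A) (λ v → cv (A & B) (inl v)) (split (W A) (λ v → wv (A & B) (inl v)) (gv (A & B)))) ⟦ A ⟧
  & subL (split (C B) (λ v → cv (A & B) (inr (C A) v)) (split (W B) (λ v → wv (A & B) (inr (W A) v)) (gv (A & B)))) ⟦ B ⟧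
⟦ A ⊕ B ⟧ =
  condₗ (wv (A ⊕ B) (inr (W A) (inr (W B) here)))
    (subL (split (C A) (λ v → cv (A ⊕ B) (inl v)) (split (W A) (λ v → wv (A ⊕ B) (inl v)) (gv (A ⊕ B)))) ⟦ A ⟧)
    (subL (split (C B) (λ v → cv (A ⊕ B) (inr (C A) v)) (split (W B) (λ v → wv (A ⊕ B) (inr (W A) (inl v))) (gv (A ⊕ B)))) ⟦ B ⟧)
⟦ A ⊸ B ⟧ =
  subL (split (C A) fxw (split (W A) x (gv (A ⊸ B)))) ⟦ A ⟧
  ⊸ subL (split (C B) w (split (W B) gx (gv (A ⊸ B)))) ⟦ B ⟧
  where
    x : Sub _ (W A)
    x v = cv (A ⊸ B) (inl v)
    w : Sub _ (C B)
    w v = cv (A ⊸ B) (inr (W A) v)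
    fxw : Sub _ (C A)
    fxw v = apps (C B) (apps (W A) (wv (A ⊸ B) (inl (mapVar (arrTy (W A) (C B)) v))) x) w
    gx : Sub _ (W B)
    gx v = apps (W A) (wv (A ⊸ B) (inr (map (arrTy (W A) (C B)) (C A)) (mapVar (W A ⇒*_) v))) x
⟦ ! A ⟧ = ! Alₗ* (C A) ⟦ A ⟧
⟦ Alₗ σ A ⟧ =
  subL (split (C A) (λ v → cv (Alₗ σ A) (inl v)) (split (W A) fz (z ∷ˢ gv (Alₗ σ A)))) ⟦ A ⟧
  where
    z : Tm _ σ
    z = cv (Alₗ σ A) (inr (C A) here)
    fz : Sub _ (W A)
    fz v = app (wv (Alₗ σ A) (mapVar (σ ⇒_) v)) z
⟦ Exₗ σ A ⟧ =
  subL (split (C A) (cv (Exₗ σ A))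
         (split (W A) (λ v → wv (Exₗ σ A) (inl v))
                (wv (Exₗ σ A) (inr (W A) here) ∷ˢ gv (Exₗ σ A)))) ⟦ A ⟧

-- A° has no challenges, and its witnesses have exactly the types of the
-- modified realizers of A; |A°|^𝐱 as a formula in the realizer variables 𝐱.

C° : ∀ {Γ} (A : Fm Γ) → C (A °) ≡ []
C° (atm a)  = refl
C° ⊥ᶠ       = refl
C° (A ∧ B)  = cong₂ _++_ (C° A) (C° B)
C° (A ∨ B)  = cong₂ _++_ (C° A) (C° B)
C° (A ⇛ B)  = refl
C° (Al σ A) = refl
C° (Ex σ A) = C° A

W° : ∀ {Γ} (A : Fm Γ) → W (A °) ≡ τ A
W° (atm a)  = refl
W° ⊥ᶠ       = refl
W° (A ∧ B)  = cong₂ _++_ (W° A) (W° B)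
W° (A ∨ B)  = cong₂ _++_ (W° A) (cong (_++ [ 𝔹 ]) (W° B))
W° (A ⇛ B) rewrite C° A | W° A | W° B = refl
W° (Al σ A) = cong (map (σ ⇒_)) (W° A)
W° (Ex σ A) = cong (_++ [ σ ]) (W° A)

∣_°∣ : ∀ {Γ} (A : Fm Γ) → LFm (τ A ++ Γ)
∣_°∣ {Γ} A =
  subst (λ Δ → LFm (Δ ++ Γ)) (W° A)
    (subst (λ Δ → LFm (Δ ++ W (A °) ++ Γ)) (C° A) ⟦ A ° ⟧)

infix 4 _⟶_
data _⟶_ {Γ : Ctx} : ∀ {σ} → Tm Γ σ → Tm Γ σ → Set where
  β      : ∀ {σ τ} (t : Tm (σ ∷ Γ) τ) (s : Tm Γ σ) → app (lam t) s ⟶ sub (s ∷ˢ var) t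
  rec0   : ∀ {σ} (z : Tm Γ σ) f → Rec z f 𝟎 ⟶ z
  recS   : ∀ {σ} (z : Tm Γ σ) f n → Rec z f (𝐒 n) ⟶ app (app f n) (Rec z f n)
  condT  : ∀ {σ} (s t : Tm Γ σ) → Cond 𝐓 s t ⟶ s
  condF  : ∀ {σ} (s t : Tm Γ σ) → Cond 𝐅 s t ⟶ t

infix 3 _⊢_
data _⊢_ : ∀ {Γ : Ctx} → List (LFm Γ) → LFm Γ → Set where
  ax    : ∀ {Γ} {A : LFm Γ} → [ A ] ⊢ A
  cut   : ∀ {Γ} {Δ₁ Δ₂ : List (LFm Γ)} {A B} → Δ₁ ⊢ A → A ∷ Δ₂ ⊢ B → Δ₁ ++ Δ₂ ⊢ B
  exch  : ∀ {Γ} {Δ Δ′ : List (LFm Γ)} {B} → Δ ↭ Δ′ → Δ ⊢ B → Δ′ ⊢ B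
  ⊗L    : ∀ {Γ} {Δ : List (LFm Γ)} {A B D} → A ∷ B ∷ Δ ⊢ D → A ⊗ B ∷ Δ ⊢ D
  ⊗R    : ∀ {Γ} {Δ₁ Δ₂ : List (LFm Γ)} {A B} → Δ₁ ⊢ A → Δ₂ ⊢ B → Δ₁ ++ Δ₂ ⊢ A ⊗ B
  ⊸L    : ∀ {Γ} {Δ₁ Δ₂ : List (LFm Γ)} {A B D} → Δ₁ ⊢ A → B ∷ Δ₂ ⊢ D → (A ⊸ B) ∷ Δ₁ ++ Δ₂ ⊢ D
  ⊸R    : ∀ {Γ} {Δ : List (LFm Γ)} {A B} → A ∷ Δ ⊢ B → Δ ⊢ A ⊸ B
  𝟘L    : ∀ {Γ} {Δ : List (LFm Γ)} {D} → 𝟘 ∷ Δ ⊢ D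
  &L₁   : ∀ {Γ} {Δ : List (LFm Γ)} {A B D} → A ∷ Δ ⊢ D → A & B ∷ Δ ⊢ D
  &L₂   : ∀ {Γ} {Δ : List (LFm Γ)} {A B D} → B ∷ Δ ⊢ D → A & B ∷ Δ ⊢ D
  &R    : ∀ {Γ} {Δ : List (LFm Γ)} {A B} → Δ ⊢ A → Δ ⊢ B → Δ ⊢ A & B
  ⊕L    : ∀ {Γ} {Δ : List (LFm Γ)} {A B D} → A ∷ Δ ⊢ D → B ∷ Δ ⊢ D → A ⊕ B ∷ Δ ⊢ D
  ⊕R₁   : ∀ {Γ} {Δ : List (LFm Γ)} {A B} → Δ ⊢ A → Δ ⊢ A ⊕ B
  ⊕R₂   : ∀ {Γ} {Δ : List (LFm Γ)} {A B} → Δ ⊢ B → Δ ⊢ A ⊕ B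
  !W    : ∀ {Γ} {Δ : List (LFm Γ)} {A D} → Δ ⊢ D → ! A ∷ Δ ⊢ D
  !C    : ∀ {Γ} {Δ : List (LFm Γ)} {A D} → ! A ∷ ! A ∷ Δ ⊢ D → ! A ∷ Δ ⊢ D
  !D    : ∀ {Γ} {Δ : List (LFm Γ)} {A D} → A ∷ Δ ⊢ D → ! A ∷ Δ ⊢ D
  !P    : ∀ {Γ} {Δ : List (LFm Γ)} {A} → map !_ Δ ⊢ A → map !_ Δ ⊢ ! A
  -- quantifiers (eigenvariables = extension of the variable context)
  ∀L    : ∀ {Γ σ} {Δ : List (LFm Γ)} {A : LFm (σ ∷ Γ)} {D} (t : Tm Γ σ) →
          A [ t ]ₗ ∷ Δ ⊢ D → Alₗ σ A ∷ Δ ⊢ D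
  ∀R    : ∀ {Γ σ} {Δ : List (LFm Γ)} {A : LFm (σ ∷ Γ)} → map wkL Δ ⊢ A → Δ ⊢ Alₗ σ A
  ∃L    : ∀ {Γ σ} {Δ : List (LFm Γ)} {A : LFm (σ ∷ Γ)} {D} →
          A ∷ map wkL Δ ⊢ wkL D → Exₗ σ A ∷ Δ ⊢ D
  ∃R    : ∀ {Γ σ} {Δ : List (LFm Γ)} {A : LFm (σ ∷ Γ)} (t : Tm Γ σ) →
          Δ ⊢ A [ t ]ₗ → Δ ⊢ Exₗ σ A
  refl≐ : ∀ {Γ σ} (t : Tm Γ σ) → [] ⊢ atm (t ≐ t)
  leib  : ∀ {Γ σ} (A : LFm (σ ∷ Γ)) (s t : Tm Γ σ) →
          atm (s ≐ t) ∷ A [ s ]ₗ ∷ [] ⊢ A [ t ]ₗ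
  conv  : ∀ {Γ σ} {s t : Tm Γ σ} → s ⟶ t → [] ⊢ atm (s ≐ t)
  T≠F   : ∀ {Γ} → atm (𝐓 ≐ 𝐅) ∷ [] ⊢ 𝟘 {Γ}
  bool  : ∀ {Γ} (t : Tm Γ 𝔹) → [] ⊢ ! atm (t ≐ 𝐓) ⊕ ! atm (t ≐ 𝐅)
  ind   : ∀ {Γ} {Δ : List (LFm Γ)} (A : LFm (ι ∷ Γ)) →
          map !_ Δ ⊢ A [ 𝟎 ]ₗ →
          A ∷ map wkL (map !_ Δ) ⊢ subL (𝐒 (var here) ∷ˢ (λ v → var (there v))) A →
          (t : Tm Γ ι) → map !_ Δ ⊢ A [ t ]ₗ

module Submission where

-- The proof is by induction on A, strengthened to all substitution instances
-- subL s ∣A°∣ ⊣⊢ subL s (mr A)° : in a compound formula both sides contain the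
-- components only after a renaming of the realizer variables, and provability
-- is not otherwise known to be closed under substitution.
--   1. Algebra of renamings and substitutions, and its interaction with ° ,
--      ∀-blocks, split and apps.
--   2. Derived rules: congruence of ⊣⊢ , the ! / ∀ interplay, duplicability of
--      every A° , and  cond_z(X,Y) ⊣⊢ !(!(z=T) ⊸ X) ⊗ !(!(z=F) ⊸ Y) .
--   3. Unfolding ∣A°∣ (defined by transports along C(A°) ≡ [] , W(A°) ≡ τ A)
--      for each connective, via uniqueness of identity proofs on List Ty.
--   4. The strengthened statement by induction on A, and the theorem.

open import Defs
open import Data.List using (List; []; _∷_; _++_; map; [_])
open import Data.List.Properties using (≡-dec)
open import Data.List.Relation.Binary.Permutation.Propositional as ↭ using (_↭_; prep; swap)
open import Data.Product using (_×_; _,_; proj₁; proj₂)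
open import Relation.Nullary using (yes; no)
open import Relation.Binary.Definitions using (DecidableEquality)
open import Relation.Binary.PropositionalEquality
  using (_≡_; refl; sym; trans; cong; cong₂; subst)
open import Axiom.UniquenessOfIdentityProofs using (module Decidable⇒UIP)

cong₃ : ∀ {A B C D : Set} (f : A → B → C → D) {a a′ b b′ c c′} →
  a ≡ a′ → b ≡ b′ → c ≡ c′ → f a b c ≡ f a′ b′ c′
cong₃ f refl refl refl = refl

-- 1. Renamings and substitutions

infix 4 _≈ʳ_ _≈ˢ_

_≈ʳ_ : ∀ {Δ Γ} → Ren Δ Γ → Ren Δ Γ → Set
_≈ʳ_ {Γ = Γ} r r′ = ∀ {σ} (v : Γ ∋ σ) → r v ≡ r′ v

_≈ˢ_ : ∀ {Δ Γ} → Sub Δ Γ → Sub Δ Γ → Set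
_≈ˢ_ {Γ = Γ} s s′ = ∀ {σ} (v : Γ ∋ σ) → s v ≡ s′ v

infixr 9 _∘ˢ_
_∘ˢ_ : ∀ {Θ Δ Γ} → Sub Θ Δ → Sub Δ Γ → Sub Θ Γ
(s ∘ˢ t) v = sub s (t v)

liftR-ext : ∀ {Δ Γ σ} {r r′ : Ren Δ Γ} → r ≈ʳ r′ → liftR {σ = σ} r ≈ʳ liftR r′
liftR-ext e here      = refl
liftR-ext e (there v) = cong there (e v)

ren-ext : ∀ {Δ Γ σ} {r r′ : Ren Δ Γ} → r ≈ʳ r′ → (t : Tm Γ σ) → ren r t ≡ ren r′ t
ren-ext e (var v)      = cong var (e v)
ren-ext e (lam t)      = cong lam (ren-ext (liftR-ext e) t)
ren-ext e (app t u)    = cong₂ app (ren-ext e t) (ren-ext e u)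
ren-ext e 𝟎            = refl
ren-ext e (𝐒 t)        = cong 𝐒 (ren-ext e t)
ren-ext e (Rec z f n)  = cong₃ Rec (ren-ext e z) (ren-ext e f) (ren-ext e n)
ren-ext e 𝐓            = refl
ren-ext e 𝐅            = refl
ren-ext e (Cond b t u) = cong₃ Cond (ren-ext e b) (ren-ext e t) (ren-ext e u)

liftS-ext : ∀ {Δ Γ σ} {s s′ : Sub Δ Γ} → s ≈ˢ s′ → liftS {σ = σ} s ≈ˢ liftS s′
liftS-ext e here      = refl
liftS-ext e (there v) = cong (ren there) (e v)

sub-ext : ∀ {Δ Γ σ} {s s′ : Sub Δ Γ} → s ≈ˢ s′ → (t : Tm Γ σ) → sub s t ≡ sub s′ t
sub-ext e (var v)      = e v
sub-ext e (lam t)      = cong lam (sub-ext (liftS-ext e) t)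
sub-ext e (app t u)    = cong₂ app (sub-ext e t) (sub-ext e u)
sub-ext e 𝟎            = refl
sub-ext e (𝐒 t)        = cong 𝐒 (sub-ext e t)
sub-ext e (Rec z f n)  = cong₃ Rec (sub-ext e z) (sub-ext e f) (sub-ext e n)
sub-ext e 𝐓            = refl
sub-ext e 𝐅            = refl
sub-ext e (Cond b t u) = cong₃ Cond (sub-ext e b) (sub-ext e t) (sub-ext e u)

ren-ren : ∀ {Θ Δ Γ σ} (r : Ren Θ Δ) (r′ : Ren Δ Γ) (t : Tm Γ σ) →
  ren r (ren r′ t) ≡ ren (λ v → r (r′ v)) t
ren-ren r r′ (var v)      = refl
ren-ren r r′ (lam t)      =
  cong lam (trans (ren-ren (liftR r) (liftR r′) t) (ren-ext (λ { here → refl ; (there v) → refl }) t))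
ren-ren r r′ (app t u)    = cong₂ app (ren-ren r r′ t) (ren-ren r r′ u)
ren-ren r r′ 𝟎            = refl
ren-ren r r′ (𝐒 t)        = cong 𝐒 (ren-ren r r′ t)
ren-ren r r′ (Rec z f n)  = cong₃ Rec (ren-ren r r′ z) (ren-ren r r′ f) (ren-ren r r′ n)
ren-ren r r′ 𝐓            = refl
ren-ren r r′ 𝐅            = refl
ren-ren r r′ (Cond b t u) = cong₃ Cond (ren-ren r r′ b) (ren-ren r r′ t) (ren-ren r r′ u)

sub-ren : ∀ {Θ Δ Γ σ} (s : Sub Θ Δ) (r : Ren Δ Γ) (t : Tm Γ σ) →
  sub s (ren r t) ≡ sub (λ v → s (r v)) t
sub-ren s r (var v)      = refl
sub-ren s r (lam t)      =
  cong lam (trans (sub-ren (liftS s) (liftR r) t) (sub-ext (λ { here → refl ; (there v) → refl }) t))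
sub-ren s r (app t u)    = cong₂ app (sub-ren s r t) (sub-ren s r u)
sub-ren s r 𝟎            = refl
sub-ren s r (𝐒 t)        = cong 𝐒 (sub-ren s r t)
sub-ren s r (Rec z f n)  = cong₃ Rec (sub-ren s r z) (sub-ren s r f) (sub-ren s r n)
sub-ren s r 𝐓            = refl
sub-ren s r 𝐅            = refl
sub-ren s r (Cond b t u) = cong₃ Cond (sub-ren s r b) (sub-ren s r t) (sub-ren s r u)

ren-sub : ∀ {Θ Δ Γ σ} (r : Ren Θ Δ) (s : Sub Δ Γ) (t : Tm Γ σ) →
  ren r (sub s t) ≡ sub (λ v → ren r (s v)) t
ren-sub r s (var v)      = refl
ren-sub r s (lam t)      = cong lam (trans (ren-sub (liftR r) (liftS s) t) (sub-ext lift-comm t))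
  where
  lift-comm : (λ v → ren (liftR r) (liftS s v)) ≈ˢ liftS (λ v → ren r (s v))
  lift-comm here      = refl
  lift-comm (there v) = trans (ren-ren (liftR r) there (s v)) (sym (ren-ren there r (s v)))
ren-sub r s (app t u)    = cong₂ app (ren-sub r s t) (ren-sub r s u)
ren-sub r s 𝟎            = refl
ren-sub r s (𝐒 t)        = cong 𝐒 (ren-sub r s t)
ren-sub r s (Rec z f n)  = cong₃ Rec (ren-sub r s z) (ren-sub r s f) (ren-sub r s n)
ren-sub r s 𝐓            = refl
ren-sub r s 𝐅            = refl
ren-sub r s (Cond b t u) = cong₃ Cond (ren-sub r s b) (ren-sub r s t) (ren-sub r s u)

liftS-∘ˢ : ∀ {Θ Δ Γ σ} (s : Sub Θ Δ) (s′ : Sub Δ Γ) →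
  liftS {σ = σ} s ∘ˢ liftS s′ ≈ˢ liftS (s ∘ˢ s′)
liftS-∘ˢ s s′ here      = refl
liftS-∘ˢ s s′ (there v) = trans (sub-ren (liftS s) there (s′ v)) (sym (ren-sub there s (s′ v)))

sub-sub : ∀ {Θ Δ Γ σ} (s : Sub Θ Δ) (s′ : Sub Δ Γ) (t : Tm Γ σ) →
  sub s (sub s′ t) ≡ sub (s ∘ˢ s′) t
sub-sub s s′ (var v)      = refl
sub-sub s s′ (lam t)      =
  cong lam (trans (sub-sub (liftS s) (liftS s′) t) (sub-ext (liftS-∘ˢ s s′) t))
sub-sub s s′ (app t u)    = cong₂ app (sub-sub s s′ t) (sub-sub s s′ u)
sub-sub s s′ 𝟎            = refl
sub-sub s s′ (𝐒 t)        = cong 𝐒 (sub-sub s s′ t)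
sub-sub s s′ (Rec z f n)  = cong₃ Rec (sub-sub s s′ z) (sub-sub s s′ f) (sub-sub s s′ n)
sub-sub s s′ 𝐓            = refl
sub-sub s s′ 𝐅            = refl
sub-sub s s′ (Cond b t u) = cong₃ Cond (sub-sub s s′ b) (sub-sub s s′ t) (sub-sub s s′ u)

liftS-var : ∀ {Γ σ} → liftS {σ = σ} (var {Γ}) ≈ˢ var
liftS-var here      = refl
liftS-var (there v) = refl

sub-id : ∀ {Γ σ} (t : Tm Γ σ) → sub var t ≡ t
sub-id (var v)      = refl
sub-id (lam t)      = cong lam (trans (sub-ext liftS-var t) (sub-id t))
sub-id (app t u)    = cong₂ app (sub-id t) (sub-id u)
sub-id 𝟎            = refl
sub-id (𝐒 t)        = cong 𝐒 (sub-id t)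
sub-id (Rec z f n)  = cong₃ Rec (sub-id z) (sub-id f) (sub-id n)
sub-id 𝐓            = refl
sub-id 𝐅            = refl
sub-id (Cond b t u) = cong₃ Cond (sub-id b) (sub-id t) (sub-id u)

subA-ext : ∀ {Δ Γ} {s s′ : Sub Δ Γ} → s ≈ˢ s′ → (a : Atom Γ) → subA s a ≡ subA s′ a
subA-ext e (t ≐ u) = cong₂ _≐_ (sub-ext e t) (sub-ext e u)

subL-ext : ∀ {Δ Γ} {s s′ : Sub Δ Γ} → s ≈ˢ s′ → (A : LFm Γ) → subL s A ≡ subL s′ A
subL-ext e (atm a)   = cong atm (subA-ext e a)
subL-ext e 𝟘         = refl
subL-ext e (A ⊗ B)   = cong₂ _⊗_ (subL-ext e A) (subL-ext e B)
subL-ext e (A & B)   = cong₂ _&_ (subL-ext e A) (subL-ext e B)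
subL-ext e (A ⊕ B)   = cong₂ _⊕_ (subL-ext e A) (subL-ext e B)
subL-ext e (A ⊸ B)   = cong₂ _⊸_ (subL-ext e A) (subL-ext e B)
subL-ext e (! A)     = cong !_ (subL-ext e A)
subL-ext e (Alₗ σ A) = cong (Alₗ σ) (subL-ext (liftS-ext e) A)
subL-ext e (Exₗ σ A) = cong (Exₗ σ) (subL-ext (liftS-ext e) A)

subA-sub : ∀ {Θ Δ Γ} (s : Sub Θ Δ) (s′ : Sub Δ Γ) (a : Atom Γ) →
  subA s (subA s′ a) ≡ subA (s ∘ˢ s′) a
subA-sub s s′ (t ≐ u) = cong₂ _≐_ (sub-sub s s′ t) (sub-sub s s′ u)

subL-sub : ∀ {Θ Δ Γ} (s : Sub Θ Δ) (s′ : Sub Δ Γ) (A : LFm Γ) →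
  subL s (subL s′ A) ≡ subL (s ∘ˢ s′) A
subL-sub s s′ (atm a)   = cong atm (subA-sub s s′ a)
subL-sub s s′ 𝟘         = refl
subL-sub s s′ (A ⊗ B)   = cong₂ _⊗_ (subL-sub s s′ A) (subL-sub s s′ B)
subL-sub s s′ (A & B)   = cong₂ _&_ (subL-sub s s′ A) (subL-sub s s′ B)
subL-sub s s′ (A ⊕ B)   = cong₂ _⊕_ (subL-sub s s′ A) (subL-sub s s′ B)
subL-sub s s′ (A ⊸ B)   = cong₂ _⊸_ (subL-sub s s′ A) (subL-sub s s′ B)
subL-sub s s′ (! A)     = cong !_ (subL-sub s s′ A)
subL-sub s s′ (Alₗ σ A) =
  cong (Alₗ σ) (trans (subL-sub (liftS s) (liftS s′) A) (subL-ext (liftS-∘ˢ s s′) A))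
subL-sub s s′ (Exₗ σ A) =
  cong (Exₗ σ) (trans (subL-sub (liftS s) (liftS s′) A) (subL-ext (liftS-∘ˢ s s′) A))

subL-fuse : ∀ {Θ Δ Γ} {s : Sub Θ Δ} {s′ : Sub Δ Γ} {u : Sub Θ Γ} →
  s ∘ˢ s′ ≈ˢ u → (A : LFm Γ) → subL s (subL s′ A) ≡ subL u A
subL-fuse {s = s} {s′} e A = trans (subL-sub s s′ A) (subL-ext e A)

subA-id : ∀ {Γ} (a : Atom Γ) → subA var a ≡ a
subA-id (t ≐ u) = cong₂ _≐_ (sub-id t) (sub-id u)

subL-id : ∀ {Γ} (A : LFm Γ) → subL var A ≡ A
subL-id (atm a)   = cong atm (subA-id a)
subL-id 𝟘         = refl
subL-id (A ⊗ B)   = cong₂ _⊗_ (subL-id A) (subL-id B)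
subL-id (A & B)   = cong₂ _&_ (subL-id A) (subL-id B)
subL-id (A ⊕ B)   = cong₂ _⊕_ (subL-id A) (subL-id B)
subL-id (A ⊸ B)   = cong₂ _⊸_ (subL-id A) (subL-id B)
subL-id (! A)     = cong !_ (subL-id A)
subL-id (Alₗ σ A) = cong (Alₗ σ) (trans (subL-ext liftS-var A) (subL-id A))
subL-id (Exₗ σ A) = cong (Exₗ σ) (trans (subL-ext liftS-var A) (subL-id A))

subL-° : ∀ {Δ Γ} (s : Sub Δ Γ) (A : Fm Γ) → subL s (A °) ≡ subF s A °
subL-° s (atm a)  = refl
subL-° s ⊥ᶠ       = refl
subL-° s (A ∧ B)  = cong₂ _⊗_ (subL-° s A) (subL-° s B)
subL-° s (A ∨ B)  = cong₂ _⊕_ (subL-° s A) (subL-° s B)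
subL-° s (A ⇛ B)  = cong !_ (cong₂ _⊸_ (subL-° s A) (subL-° s B))
subL-° s (Al σ A) = cong (λ X → ! Alₗ σ X) (subL-° (liftS s) A)
subL-° s (Ex σ A) = cong (Exₗ σ) (subL-° (liftS s) A)

-- Weakening under the binder and instantiating with the bound variable is the
-- identity; this is the eigenvariable step of every ∀/∃ congruence.
inst-wk : ∀ {Γ σ} (A : LFm (σ ∷ Γ)) → subL (liftS (λ v → var (there v))) A [ var here ]ₗ ≡ A
inst-wk A = trans (subL-fuse (λ { here → refl ; (there v) → refl }) A) (subL-id A)

lift* : ∀ (Δ : Ctx) {Θ Γ} → Sub Θ Γ → Sub (Δ ++ Θ) (Δ ++ Γ)
lift* []      s = s
lift* (σ ∷ Δ) s = liftS (lift* Δ s)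

subL-Alₗ* : ∀ (Δ : Ctx) {Θ Γ} (s : Sub Θ Γ) (F : LFm (Δ ++ Γ)) →
  subL s (Alₗ* Δ F) ≡ Alₗ* Δ (subL (lift* Δ s) F)
subL-Alₗ* []      s F = refl
subL-Alₗ* (σ ∷ Δ) s F = subL-Alₗ* Δ s (Alₗ σ F)

subF-Al* : ∀ (Δ : Ctx) {Θ Γ} (s : Sub Θ Γ) (F : Fm (Δ ++ Γ)) →
  subF s (Al* Δ F) ≡ Al* Δ (subF (lift* Δ s) F)
subF-Al* []      s F = refl
subF-Al* (σ ∷ Δ) s F = subF-Al* Δ s (Al σ F)

split-inl : ∀ (Δ : Ctx) {Θ Γ σ} (s : Sub Θ Δ) (t : Sub Θ Γ) (v : Δ ∋ σ) → split Δ s t (inl v) ≡ s v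
split-inl (τ ∷ Δ) s t here      = refl
split-inl (τ ∷ Δ) s t (there v) = split-inl Δ (λ w → s (there w)) t v

split-inr : ∀ (Δ : Ctx) {Θ Γ σ} (s : Sub Θ Δ) (t : Sub Θ Γ) (v : Γ ∋ σ) → split Δ s t (inr Δ v) ≡ t v
split-inr []      s t v = refl
split-inr (τ ∷ Δ) s t v = split-inr Δ (λ w → s (there w)) t v

split-unique : ∀ (Δ : Ctx) {Θ Γ} {s : Sub Θ Δ} {t : Sub Θ Γ} (u : Sub Θ (Δ ++ Γ)) →
  (∀ {σ} (v : Δ ∋ σ) → u (inl v) ≡ s v) → (∀ {σ} (g : Γ ∋ σ) → u (inr Δ g) ≡ t g) →
  u ≈ˢ split Δ s t
split-unique []      u onΔ onΓ v         = onΓ v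
split-unique (τ ∷ Δ) u onΔ onΓ here      = onΔ here
split-unique (τ ∷ Δ) u onΔ onΓ (there v) =
  split-unique Δ (λ w → u (there w)) (λ w → onΔ (there w)) onΓ v

∘ˢ-split : ∀ (Δ : Ctx) {Ξ Θ Γ} (s : Sub Ξ Θ) (a : Sub Θ Δ) (b : Sub Θ Γ) {a′ : Sub Ξ Δ} {b′ : Sub Ξ Γ} →
  s ∘ˢ a ≈ˢ a′ → s ∘ˢ b ≈ˢ b′ → s ∘ˢ split Δ a b ≈ˢ split Δ a′ b′
∘ˢ-split Δ s a b onΔ onΓ = split-unique Δ (s ∘ˢ split Δ a b)
  (λ v → trans (cong (sub s) (split-inl Δ a b v)) (onΔ v))
  (λ g → trans (cong (sub s) (split-inr Δ a b g)) (onΓ g))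

sub-apps : ∀ (Δ : Ctx) {Θ Γ ρ} (s : Sub Θ Γ) (t : Tm Γ (Δ ⇒* ρ)) (u : Sub Γ Δ) →
  sub s (apps Δ t u) ≡ apps Δ (sub s t) (s ∘ˢ u)
sub-apps []      s t u = refl
sub-apps (σ ∷ Δ) s t u = sub-apps Δ s (app t (u here)) (λ v → u (there v))

apps-cong : ∀ (Δ : Ctx) {Θ ρ} {t t′ : Tm Θ (Δ ⇒* ρ)} {u u′ : Sub Θ Δ} →
  t ≡ t′ → u ≈ˢ u′ → apps Δ t u ≡ apps Δ t′ u′
apps-cong []      refl e = refl
apps-cong (σ ∷ Δ) refl e = apps-cong Δ (cong (app _) (e here)) (λ v → e (there v))

-- 2. Derived rules of ILL^ω_b

infix 3 _⊣⊢_
_⊣⊢_ : ∀ {Γ} → LFm Γ → LFm Γ → Set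
X ⊣⊢ Y = (X ∷ [] ⊢ Y) × (Y ∷ [] ⊢ X)

⊣⊢-refl : ∀ {Γ} {X : LFm Γ} → X ⊣⊢ X
⊣⊢-refl = ax , ax

⊣⊢-sym : ∀ {Γ} {X Y : LFm Γ} → X ⊣⊢ Y → Y ⊣⊢ X
⊣⊢-sym (d , e) = e , d

⊣⊢-trans : ∀ {Γ} {X Y Z : LFm Γ} → X ⊣⊢ Y → Y ⊣⊢ Z → X ⊣⊢ Z
⊣⊢-trans (d , e) (d′ , e′) = cut d d′ , cut e′ e

⊣⊢-≡ : ∀ {Γ} {X X′ Y Y′ : LFm Γ} → X ≡ X′ → Y ≡ Y′ → X′ ⊣⊢ Y′ → X ⊣⊢ Y
⊣⊢-≡ refl refl e = e

exch₂ : ∀ {Γ} {X Y : LFm Γ} {Δ : List (LFm Γ)} {G} → X ∷ Y ∷ Δ ⊢ G → Y ∷ X ∷ Δ ⊢ G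
exch₂ = exch (swap _ _ ↭.refl)

cut₂ : ∀ {Γ} {X Y Y′ G : LFm Γ} → Y ∷ [] ⊢ Y′ → X ∷ Y′ ∷ [] ⊢ G → X ∷ Y ∷ [] ⊢ G
cut₂ e d = exch₂ (cut e (exch₂ d))

⊗-mono : ∀ {Γ} {X X′ Y Y′ : LFm Γ} → X ∷ [] ⊢ X′ → Y ∷ [] ⊢ Y′ → X ⊗ Y ∷ [] ⊢ X′ ⊗ Y′
⊗-mono d e = ⊗L (⊗R d e)

⊸-mono : ∀ {Γ} {X X′ Y Y′ : LFm Γ} → X′ ∷ [] ⊢ X → Y ∷ [] ⊢ Y′ → X ⊸ Y ∷ [] ⊢ X′ ⊸ Y′
⊸-mono d e = ⊸R (exch₂ (⊸L d e))

!-mono : ∀ {Γ} {X Y : LFm Γ} → X ∷ [] ⊢ Y → ! X ∷ [] ⊢ ! Y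
!-mono {X = X} d = !P {Δ = X ∷ []} (!D d)

∀-mono : ∀ {Γ σ} {X Y : LFm (σ ∷ Γ)} → X ∷ [] ⊢ Y → Alₗ σ X ∷ [] ⊢ Alₗ σ Y
∀-mono {X = X} d = ∀R (∀L (var here) (subst (λ Z → Z ∷ [] ⊢ _) (sym (inst-wk X)) d))

∀*-mono : ∀ (Δ : Ctx) {Γ} {X Y : LFm (Δ ++ Γ)} → X ∷ [] ⊢ Y → Alₗ* Δ X ∷ [] ⊢ Alₗ* Δ Y
∀*-mono []      d = d
∀*-mono (σ ∷ Δ) d = ∀*-mono Δ (∀-mono d)

⊗-cong : ∀ {Γ} {X X′ Y Y′ : LFm Γ} → X ⊣⊢ X′ → Y ⊣⊢ Y′ → X ⊗ Y ⊣⊢ X′ ⊗ Y′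
⊗-cong (d , d′) (e , e′) = ⊗-mono d e , ⊗-mono d′ e′

⊸-cong : ∀ {Γ} {X X′ Y Y′ : LFm Γ} → X ⊣⊢ X′ → Y ⊣⊢ Y′ → X ⊸ Y ⊣⊢ X′ ⊸ Y′
⊸-cong (d , d′) (e , e′) = ⊸-mono d′ e , ⊸-mono d e′

!-cong : ∀ {Γ} {X Y : LFm Γ} → X ⊣⊢ Y → ! X ⊣⊢ ! Y
!-cong (d , e) = !-mono d , !-mono e

∀-cong : ∀ {Γ σ} {X Y : LFm (σ ∷ Γ)} → X ⊣⊢ Y → Alₗ σ X ⊣⊢ Alₗ σ Y
∀-cong (d , e) = ∀-mono d , ∀-mono e

∀*-cong : ∀ (Δ : Ctx) {Γ} {X Y : LFm (Δ ++ Γ)} → X ⊣⊢ Y → Alₗ* Δ X ⊣⊢ Alₗ* Δ Y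
∀*-cong Δ (d , e) = ∀*-mono Δ d , ∀*-mono Δ e

!∀-distrib : ∀ {Γ σ} (H : LFm (σ ∷ Γ)) → ! Alₗ σ H ∷ [] ⊢ Alₗ σ (! H)
!∀-distrib H = ∀R (!P {Δ = Alₗ _ (subL (liftS (λ v → var (there v))) H) ∷ []}
                   (!D (∀L (var here) (subst (λ Z → Z ∷ [] ⊢ _) (sym (inst-wk H)) ax))))

!∀*-distrib : ∀ (Δ : Ctx) {Γ} (H : LFm (Δ ++ Γ)) → ! Alₗ* Δ H ∷ [] ⊢ Alₗ* Δ (! H)
!∀*-distrib []      H = ax
!∀*-distrib (σ ∷ Δ) H = cut (!∀*-distrib Δ (Alₗ σ H)) (∀*-mono Δ (!∀-distrib H))

!∀*!-absorb : ∀ (Δ : Ctx) {Γ} (H : LFm (Δ ++ Γ)) → ! Alₗ* Δ (! H) ⊣⊢ ! Alₗ* Δ H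
!∀*!-absorb Δ H = !-mono (∀*-mono Δ (!D ax)) , !P {Δ = Alₗ* Δ H ∷ []} (!∀*-distrib Δ H)

-- Every translated formula is duplicable:  F° ⊢ !F° .  This is what allows
-- the linear disjunction to be compared with the banged implications of mr.
°-promote : ∀ {Γ} (F : Fm Γ) → F ° ∷ [] ⊢ ! (F °)
°-promote (atm a)  = !P {Δ = atm a ∷ []} ax
°-promote ⊥ᶠ       = 𝟘L
°-promote (A ∧ B)  =
  ⊗L (cut (°-promote A) (cut₂ (°-promote B) (!P {Δ = A ° ∷ B ° ∷ []} (⊗R (!D ax) (!D ax)))))
°-promote (A ∨ B)  = ⊕L (cut (°-promote A) (!P {Δ = A ° ∷ []} (⊕R₁ (!D ax))))
                        (cut (°-promote B) (!P {Δ = B ° ∷ []} (⊕R₂ (!D ax))))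
°-promote (A ⇛ B)  = !P {Δ = (A ° ⊸ B °) ∷ []} ax
°-promote (Al σ A) = !P {Δ = Alₗ σ (A °) ∷ []} ax
°-promote (Ex σ A) =
  ∃L (cut (°-promote A) (!P {Δ = A ° ∷ []}
       (∃R (var here) (subst (λ Z → ! (A °) ∷ [] ⊢ Z) (sym (inst-wk (A °))) (!D ax)))))

°-promote-sub : ∀ {Δ Γ} (s : Sub Δ Γ) (F : Fm Γ) → subL s (F °) ∷ [] ⊢ ! subL s (F °)
°-promote-sub s F = subst (λ Z → Z ∷ [] ⊢ ! Z) (sym (subL-° s F)) (°-promote (subF s F))

Al*-° : ∀ (Δ : Ctx) {Γ} (F : Fm (Δ ++ Γ)) → Al* Δ F ° ⊣⊢ ! Alₗ* Δ (F °)
Al*-° []      F = °-promote F , !D ax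
Al*-° (σ ∷ Δ) F = ⊣⊢-trans (Al*-° Δ (Al σ F)) (!∀*!-absorb Δ (Alₗ σ (F °)))

-- Left to right, case on z ∈ {T, F} (axiom bool): the branch for the actual
-- value of z is used and duplicated, the other implication holds vacuously
-- because T ≠ F.  Right to left, each implication yields its branch.
module _ {Γ : Ctx} (z : Tm Γ 𝔹) {X X′ Y Y′ : LFm Γ}
         (X⊣⊢X′ : X ⊣⊢ X′) (X′-dup : X′ ∷ [] ⊢ ! X′)
         (Y⊣⊢Y′ : Y ⊣⊢ Y′) (Y′-dup : Y′ ∷ [] ⊢ ! Y′) where
  private
    isT isF : LFm Γ
    isT = ! atm (z ≐ 𝐓)
    isF = ! atm (z ≐ 𝐅)

    pair : LFm Γ
    pair = ! (isT ⊸ X′) ⊗ ! (isF ⊸ Y′)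

    both-absurd : ∀ {D} → isF ∷ isT ∷ [] ⊢ D
    both-absurd =
      cut (exch₂ (!D (exch₂ (!D (exch₂ (cut (leib (atm (var here ≐ 𝐅)) z 𝐓) T≠F)))))) 𝟘L

    reorder : ∀ {P Q : LFm Γ} → P ∷ Q ∷ Q ∷ [] ↭ Q ∷ Q ∷ P ∷ []
    reorder = ↭.trans (swap _ _ ↭.refl) (prep _ (swap _ _ ↭.refl))

    case-T : isT ∷ condₗ z X Y ∷ [] ⊢ pair
    case-T = !C (exch reorder (cut (cut (&L₁ (⊸L ax (proj₁ X⊣⊢X′))) X′-dup)
               (⊗R (!P {Δ = X′ ∷ []} (⊸R (!W (!D ax))))
                   (!P {Δ = atm (z ≐ 𝐓) ∷ []} (⊸R both-absurd)))))

    case-F : isF ∷ condₗ z X Y ∷ [] ⊢ pair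
    case-F = !C (exch reorder (cut (cut (&L₂ (⊸L ax (proj₁ Y⊣⊢Y′))) Y′-dup)
               (exch₂ (⊗R (!P {Δ = atm (z ≐ 𝐅) ∷ []} (⊸R (exch₂ both-absurd)))
                          (!P {Δ = Y′ ∷ []} (⊸R (!W (!D ax))))))))

    from-pair : pair ∷ [] ⊢ condₗ z X Y
    from-pair = ⊗L (&R
      (⊸R (exch (↭.trans (swap _ _ ↭.refl) (↭.trans (prep _ (swap _ _ ↭.refl)) (swap _ _ ↭.refl)))
                (!W (!D (⊸L ax (proj₂ X⊣⊢X′))))))
      (⊸R (exch (↭.trans (prep _ (swap _ _ ↭.refl)) (swap _ _ ↭.refl))
                (!W (!D (⊸L ax (proj₂ Y⊣⊢Y′)))))))

  cond-⊣⊢ : condₗ z X Y ⊣⊢ ! (! atm (z ≐ 𝐓) ⊸ X′) ⊗ ! (! atm (z ≐ 𝐅) ⊸ Y′)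
  cond-⊣⊢ = cut (bool z) (⊕L case-T case-F) , from-pair

-- 3. Unfolding ∣ A °∣ connective by connective

-- Equality of finite types is decidable, so equality proofs between lists of
-- types are unique; this lets the transports in ∣_°∣ be computed.
_≟Ty_ : DecidableEquality Ty
ι ≟Ty ι = yes refl
ι ≟Ty 𝔹 = no (λ ())
ι ≟Ty (_ ⇒ _) = no (λ ())
𝔹 ≟Ty ι = no (λ ())
𝔹 ≟Ty 𝔹 = yes refl
𝔹 ≟Ty (_ ⇒ _) = no (λ ())
(_ ⇒ _) ≟Ty ι = no (λ ())
(_ ⇒ _) ≟Ty 𝔹 = no (λ ())
(σ ⇒ τ) ≟Ty (σ′ ⇒ τ′) with σ ≟Ty σ′ | τ ≟Ty τ′
... | yes refl | yes refl = yes refl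
... | no σ≢σ′  | _        = no (λ { refl → σ≢σ′ refl })
... | yes _    | no τ≢τ′  = no (λ { refl → τ≢τ′ refl })

uip : ∀ {Δ Δ′ : List Ty} (p q : Δ ≡ Δ′) → p ≡ q
uip = Decidable⇒UIP.≡-irrelevant (≡-dec _≟Ty_)

-- The unfolding lemmas below are stated for arbitrary lists of challenge and
-- witness types so that the equations can be matched against refl.
cast : ∀ {Γ Cs Ws T : Ctx} → Cs ≡ [] → Ws ≡ T → LFm (Cs ++ Ws ++ Γ) → LFm (T ++ Γ)
cast {Γ} {Ws = Ws} p q F = subst (λ Δ → LFm (Δ ++ Γ)) q (subst (λ Δ → LFm (Δ ++ Ws ++ Γ)) p F)

unfold-∧ : ∀ {Γ L₁ L₂ W₁ W₂ T₁ T₂} (F₁ : LFm (L₁ ++ W₁ ++ Γ)) (F₂ : LFm (L₂ ++ W₂ ++ Γ))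
  (p₁ : L₁ ≡ []) (p₂ : L₂ ≡ []) (q₁ : W₁ ≡ T₁) (q₂ : W₂ ≡ T₂)
  (p : L₁ ++ L₂ ≡ []) (q : W₁ ++ W₂ ≡ T₁ ++ T₂) →
  cast p q
    (subL (split L₁ (λ v → var (inl (inl v)))
             (split W₁ (λ v → var (inr (L₁ ++ L₂) (inl (inl v))))
                       (λ v → var (inr (L₁ ++ L₂) (inr (W₁ ++ W₂) v))))) F₁
     ⊗ subL (split L₂ (λ v → var (inl (inr L₁ v)))
               (split W₂ (λ v → var (inr (L₁ ++ L₂) (inl (inr W₁ v))))
                         (λ v → var (inr (L₁ ++ L₂) (inr (W₁ ++ W₂) v))))) F₂)
  ≡ subL (split T₁ (λ v → var (inl (inl v))) (λ v → var (inr (T₁ ++ T₂) v))) (cast p₁ q₁ F₁)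
    ⊗ subL (split T₂ (λ v → var (inl (inr T₁ v))) (λ v → var (inr (T₁ ++ T₂) v))) (cast p₂ q₂ F₂)
unfold-∧ F₁ F₂ refl refl refl refl p q rewrite uip p refl | uip q refl = refl

∣∧°∣ : ∀ {Γ} (A B : Fm Γ) → ∣ A ∧ B °∣ ≡
  subL (split (τ A) (λ v → var (inl (inl v))) (λ v → var (inr (τ A ++ τ B) v))) ∣ A °∣
  ⊗ subL (split (τ B) (λ v → var (inl (inr (τ A) v))) (λ v → var (inr (τ A ++ τ B) v))) ∣ B °∣
∣∧°∣ A B = unfold-∧ ⟦ A ° ⟧ ⟦ B ° ⟧ (C° A) (C° B) (W° A) (W° B) (C° (A ∧ B)) (W° (A ∧ B))

unfold-∨ : ∀ {Γ L₁ L₂ W₁ W₂ T₁ T₂} (F₁ : LFm (L₁ ++ W₁ ++ Γ)) (F₂ : LFm (L₂ ++ W₂ ++ Γ))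
  (p₁ : L₁ ≡ []) (p₂ : L₂ ≡ []) (q₁ : W₁ ≡ T₁) (q₂ : W₂ ≡ T₂)
  (p : L₁ ++ L₂ ≡ []) (q : W₁ ++ W₂ ++ [ 𝔹 ] ≡ T₁ ++ T₂ ++ [ 𝔹 ]) →
  cast p q
    (condₗ (var (inr (L₁ ++ L₂) (inl (inr W₁ (inr W₂ here)))))
      (subL (split L₁ (λ v → var (inl (inl v)))
               (split W₁ (λ v → var (inr (L₁ ++ L₂) (inl (inl v))))
                         (λ v → var (inr (L₁ ++ L₂) (inr (W₁ ++ W₂ ++ [ 𝔹 ]) v))))) F₁)
      (subL (split L₂ (λ v → var (inl (inr L₁ v)))
               (split W₂ (λ v → var (inr (L₁ ++ L₂) (inl (inr W₁ (inl v)))))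
                         (λ v → var (inr (L₁ ++ L₂) (inr (W₁ ++ W₂ ++ [ 𝔹 ]) v))))) F₂))
  ≡ condₗ (var (inl (inr T₁ (inr T₂ here))))
      (subL (split T₁ (λ v → var (inl (inl v))) (λ v → var (inr (T₁ ++ T₂ ++ [ 𝔹 ]) v)))
            (cast p₁ q₁ F₁))
      (subL (split T₂ (λ v → var (inl (inr T₁ (inl v)))) (λ v → var (inr (T₁ ++ T₂ ++ [ 𝔹 ]) v)))
            (cast p₂ q₂ F₂))
unfold-∨ F₁ F₂ refl refl refl refl p q rewrite uip p refl | uip q refl = refl

∣∨°∣ : ∀ {Γ} (A B : Fm Γ) → ∣ A ∨ B °∣ ≡
  condₗ (var (inl (inr (τ A) (inr (τ B) here))))
    (subL (split (τ A) (λ v → var (inl (inl v))) (λ v → var (inr (τ A ++ τ B ++ [ 𝔹 ]) v))) ∣ A °∣)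
    (subL (split (τ B) (λ v → var (inl (inr (τ A) (inl v))))
                       (λ v → var (inr (τ A ++ τ B ++ [ 𝔹 ]) v))) ∣ B °∣)
∣∨°∣ A B = unfold-∨ ⟦ A ° ⟧ ⟦ B ° ⟧ (C° A) (C° B) (W° A) (W° B) (C° (A ∨ B)) (W° (A ∨ B))

unfold-∃ : ∀ {Γ σ L W T} (F : LFm (L ++ W ++ σ ∷ Γ))
  (p₁ : L ≡ []) (q₁ : W ≡ T) (p : L ≡ []) (q : W ++ [ σ ] ≡ T ++ [ σ ]) →
  cast p q
    (subL (split L (λ v → var (inl v))
             (split W (λ v → var (inr L (inl (inl v))))
                      (var (inr L (inl (inr W here))) ∷ˢ (λ v → var (inr L (inr (W ++ [ σ ]) v))))))
          F)
  ≡ subL (split T (λ v → var (inl (inl v)))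
                  (var (inl (inr T here)) ∷ˢ (λ v → var (inr (T ++ [ σ ]) v))))
         (cast p₁ q₁ F)
unfold-∃ F refl refl p q rewrite uip p refl | uip q refl = refl

∣∃°∣ : ∀ {Γ} σ (A : Fm (σ ∷ Γ)) → ∣ Ex σ A °∣ ≡
  subL (split (τ A) (λ v → var (inl (inl v)))
         (var (inl (inr (τ A) here)) ∷ˢ (λ v → var (inr (τ A ++ [ σ ]) v)))) ∣ A °∣
∣∃°∣ σ A = unfold-∃ ⟦ A ° ⟧ (C° A) (W° A) (C° (Ex σ A)) (W° (Ex σ A))

unfold-∀ : ∀ {Γ σ L W T} (F : LFm (L ++ W ++ σ ∷ Γ))
  (p₁ : L ≡ []) (q₁ : W ≡ T) (p : [] ≡ []) (q : map (σ ⇒_) W ≡ map (σ ⇒_) T) →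
  cast p q
    (! Alₗ* (L ++ [ σ ])
       (subL (split L (λ v → var (inl (inl v)))
                (split W (λ v → app (var (inr (L ++ [ σ ]) (inl (mapVar (σ ⇒_) v))))
                                    (var (inl (inr L here))))
                         (var (inl (inr L here))
                           ∷ˢ (λ v → var (inr (L ++ [ σ ]) (inr (map (σ ⇒_) W) v)))))) F))
  ≡ ! Alₗ σ (subL (split T (λ v → app (var (there (inl (mapVar (σ ⇒_) v)))) (var here))
                           (var here ∷ˢ (λ v → var (there (inr (map (σ ⇒_) T) v)))))
                  (cast p₁ q₁ F))
unfold-∀ F refl refl p q rewrite uip p refl | uip q refl = refl

∣∀°∣ : ∀ {Γ} σ (A : Fm (σ ∷ Γ)) → ∣ Al σ A °∣ ≡
  ! Alₗ σ (subL (split (τ A) (λ v → app (var (there (inl (mapVar (σ ⇒_) v)))) (var here))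
                             (var here ∷ˢ (λ v → var (there (inr (map (σ ⇒_) (τ A)) v)))))
                ∣ A °∣)
∣∀°∣ σ A = unfold-∀ ⟦ A ° ⟧ (C° A) (W° A) (C° (Al σ A)) (W° (Al σ A))

-- Implication.  (A ⇛ B)° = !(A° ⊸ B°), and the challenges of A° ⊸ B° are the
-- witnesses of A° followed by the (empty) challenges of B°; the renaming
-- unpad removes that trailing empty list from the ∀-block.
unpad : ∀ (Δ : Ctx) {Γ σ} → ((Δ ++ []) ++ Γ) ∋ σ → (Δ ++ Γ) ∋ σ
unpad []      v         = v
unpad (τ ∷ Δ) here      = here
unpad (τ ∷ Δ) (there v) = there (unpad Δ v)

unpad-inl : ∀ (Δ : Ctx) {Γ σ} (v : Δ ∋ σ) → unpad Δ {Γ} (inl (inl v)) ≡ inl v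
unpad-inl (τ ∷ Δ) here      = refl
unpad-inl (τ ∷ Δ) (there v) = cong there (unpad-inl Δ v)

unpad-inr : ∀ (Δ : Ctx) {Γ σ} (g : Γ ∋ σ) → unpad Δ (inr (Δ ++ []) g) ≡ inr Δ g
unpad-inr []      g = refl
unpad-inr (τ ∷ Δ) g = cong there (unpad-inr Δ g)

Alₗ*-unpad : ∀ (Δ : Ctx) {Γ} (G : LFm ((Δ ++ []) ++ Γ)) →
  Alₗ* (Δ ++ []) G ≡ Alₗ* Δ (subL (λ v → var (unpad Δ v)) G)
Alₗ*-unpad []      G = sym (subL-id G)
Alₗ*-unpad (τ ∷ Δ) G = trans (Alₗ*-unpad Δ (Alₗ τ G))
  (cong (λ H → Alₗ* Δ (Alₗ τ H)) (subL-ext (λ { here → refl ; (there v) → refl }) G))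

-- The body of the ∀-block of ∣(A ⇛ B)°∣, for witness types W₁ of A and W₂ of B:
-- the primed substitutions are those of the interpretation (over W₁ ++ []),
-- the unprimed ones those of mr (A ⇛ B) (over W₁).
module ⇛Body {Γ : Ctx} (W₁ W₂ : Ctx) where
  private
    Fs : Ctx
    Fs = map (W₁ ⇒*_) W₂
  -- the context of ∀-bound realizers of A, realizers f of A ⇛ B, and Γ
  Body Body′ : Ctx
  Body  = W₁ ++ Fs ++ Γ
  Body′ = (W₁ ++ []) ++ Fs ++ Γ

  x : Sub Body W₁
  x v = var (inl v)
  outer : Sub Body Γ
  outer v = var (inr W₁ (inr Fs v))
  fx : Sub Body W₂
  fx v = apps W₁ (var (inr W₁ (inl (mapVar (W₁ ⇒*_) v)))) x

  x′ : Sub Body′ W₁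
  x′ v = var (inl (inl v))
  outer′ : Sub Body′ Γ
  outer′ v = var (inr (W₁ ++ []) (inr Fs v))
  fx′ : Sub Body′ W₂
  fx′ v = apps W₁ (var (inr (W₁ ++ []) (inl (mapVar (W₁ ⇒*_) v)))) x′

  unpadˢ : Sub Body Body′
  unpadˢ v = var (unpad W₁ v)

  unpad-x : unpadˢ ∘ˢ x′ ≈ˢ x
  unpad-x v = cong var (unpad-inl W₁ v)

  unpad-premise : unpadˢ ∘ˢ split W₁ x′ outer′ ≈ˢ split W₁ x outer
  unpad-premise = ∘ˢ-split W₁ unpadˢ x′ outer′ unpad-x (λ g → cong var (unpad-inr W₁ _))

  unpad-conclusion : unpadˢ ∘ˢ split W₂ fx′ outer′ ≈ˢ split W₂ fx outer
  unpad-conclusion = ∘ˢ-split W₂ unpadˢ fx′ outer′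
    (λ v → trans (sub-apps W₁ unpadˢ _ x′) (apps-cong W₁ (cong var (unpad-inr W₁ _)) unpad-x))
    (λ g → cong var (unpad-inr W₁ _))

  unpad-body : (F₁ : LFm (W₁ ++ Γ)) (F₂ : LFm (W₂ ++ Γ)) →
    Alₗ* (W₁ ++ []) (subL (split W₁ x′ outer′) F₁ ⊸ subL (split W₂ fx′ outer′) F₂)
    ≡ Alₗ* W₁ (subL (split W₁ x outer) F₁ ⊸ subL (split W₂ fx outer) F₂)
  unpad-body F₁ F₂ = trans (Alₗ*-unpad W₁ _)
    (cong (Alₗ* W₁) (cong₂ _⊸_ (subL-fuse unpad-premise F₁) (subL-fuse unpad-conclusion F₂)))

unfold-⇛ : ∀ {Γ L₁ L₂ W₁ W₂ T₁ T₂} (F₁ : LFm (L₁ ++ W₁ ++ Γ)) (F₂ : LFm (L₂ ++ W₂ ++ Γ))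
  (p₁ : L₁ ≡ []) (p₂ : L₂ ≡ []) (q₁ : W₁ ≡ T₁) (q₂ : W₂ ≡ T₂) (p : [] ≡ [])
  (q : map (arrTy W₁ L₂) L₁ ++ map (W₁ ⇒*_) W₂ ≡ map (T₁ ⇒*_) T₂) →
  cast p q
    (! Alₗ* (W₁ ++ L₂)
      (subL (split L₁ (λ v → apps L₂ (apps W₁ (var (inr (W₁ ++ L₂) (inl (inl (mapVar (arrTy W₁ L₂) v)))))
                                              (λ v → var (inl (inl v))))
                                     (λ v → var (inl (inr W₁ v))))
               (split W₁ (λ v → var (inl (inl v)))
                  (λ v → var (inr (W₁ ++ L₂) (inr (map (arrTy W₁ L₂) L₁ ++ map (W₁ ⇒*_) W₂) v))))) F₁
       ⊸ subL (split L₂ (λ v → var (inl (inr W₁ v)))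
                 (split W₂ (λ v → apps W₁ (var (inr (W₁ ++ L₂)
                                             (inl (inr (map (arrTy W₁ L₂) L₁) (mapVar (W₁ ⇒*_) v)))))
                                          (λ v → var (inl (inl v))))
                    (λ v → var (inr (W₁ ++ L₂) (inr (map (arrTy W₁ L₂) L₁ ++ map (W₁ ⇒*_) W₂) v))))) F₂))
  ≡ ! Alₗ* T₁ (subL (split T₁ (⇛Body.x T₁ T₂) (⇛Body.outer T₁ T₂)) (cast p₁ q₁ F₁)
               ⊸ subL (split T₂ (⇛Body.fx T₁ T₂) (⇛Body.outer T₁ T₂)) (cast p₂ q₂ F₂))
unfold-⇛ {W₁ = W₁} {W₂} F₁ F₂ refl refl refl refl p q rewrite uip p refl | uip q refl =
  cong !_ (⇛Body.unpad-body W₁ W₂ F₁ F₂)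

∣⇛°∣ : ∀ {Γ} (A B : Fm Γ) → ∣ A ⇛ B °∣ ≡
  ! Alₗ* (τ A) (subL (split (τ A) (⇛Body.x (τ A) (τ B)) (⇛Body.outer (τ A) (τ B))) ∣ A °∣
                ⊸ subL (split (τ B) (⇛Body.fx (τ A) (τ B)) (⇛Body.outer (τ A) (τ B))) ∣ B °∣)
∣⇛°∣ A B = unfold-⇛ ⟦ A ° ⟧ ⟦ B ° ⟧ (C° A) (C° B) (W° A) (W° B) (C° (A ⇛ B)) (W° (A ⇛ B))

∣°∣⊣⊢mr° : ∀ {Γ} (A : Fm Γ) {Θ} (s : Sub Θ (τ A ++ Γ)) → subL s ∣ A °∣ ⊣⊢ subL s (mr A °)

-- The induction hypothesis in the form in which the unfolding equations
-- present it: ∣A°∣ and mr A first renamed by t into a compound context.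
∣°∣⊣⊢mr°-renamed : ∀ {Γ} (A : Fm Γ) {Θ Δ} (s : Sub Θ Δ) (t : Sub Δ (τ A ++ Γ)) →
  subL s (subL t ∣ A °∣) ⊣⊢ subL s (subF t (mr A) °)
∣°∣⊣⊢mr°-renamed A s t =
  ⊣⊢-≡ (subL-sub s t ∣ A °∣)
       (trans (cong (subL s) (sym (subL-° t (mr A)))) (subL-sub s t (mr A °)))
       (∣°∣⊣⊢mr° A (s ∘ˢ t))

∣°∣⊣⊢mr° (atm a)  s = ⊣⊢-refl
∣°∣⊣⊢mr° ⊥ᶠ       s = ⊣⊢-refl
∣°∣⊣⊢mr° (A ∧ B)  s = ⊣⊢-≡ (cong (subL s) (∣∧°∣ A B)) refl
  (⊗-cong (∣°∣⊣⊢mr°-renamed A s _) (∣°∣⊣⊢mr°-renamed B s _))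
∣°∣⊣⊢mr° (A ∨ B)  s = ⊣⊢-≡ (cong (subL s) (∣∨°∣ A B)) refl
  (cond-⊣⊢ _ (∣°∣⊣⊢mr°-renamed A s _) (°-promote-sub s _)
             (∣°∣⊣⊢mr°-renamed B s _) (°-promote-sub s _))
∣°∣⊣⊢mr° {Γ} (A ⇛ B) {Θ} s =
  ⊣⊢-≡ unfold-∣⇛°∣ fold-mr
    (⊣⊢-trans (!-cong (∀*-cong (τ A) components))
    (⊣⊢-trans (⊣⊢-sym (!∀*!-absorb (τ A) (P ° ⊸ Q °)))
              (⊣⊢-sym (Al*-° (τ A) (P ⇛ Q)))))
  where
  s↑ : Sub (τ A ++ Θ) (τ A ++ map (τ A ⇒*_) (τ B) ++ Γ)
  s↑ = lift* (τ A) s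
  premise : Sub (τ A ++ map (τ A ⇒*_) (τ B) ++ Γ) (τ A ++ Γ)
  premise = split (τ A) (⇛Body.x (τ A) (τ B)) (⇛Body.outer (τ A) (τ B))
  conclusion : Sub (τ A ++ map (τ A ⇒*_) (τ B) ++ Γ) (τ B ++ Γ)
  conclusion = split (τ B) (⇛Body.fx (τ A) (τ B)) (⇛Body.outer (τ A) (τ B))

  P Q : Fm (τ A ++ Θ)
  P = subF s↑ (subF premise (mr A))
  Q = subF s↑ (subF conclusion (mr B))

  unfold-∣⇛°∣ : subL s ∣ A ⇛ B °∣ ≡
    ! Alₗ* (τ A) (subL s↑ (subL premise ∣ A °∣) ⊸ subL s↑ (subL conclusion ∣ B °∣))
  unfold-∣⇛°∣ = trans (cong (subL s) (∣⇛°∣ A B)) (cong !_ (subL-Alₗ* (τ A) s _))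

  fold-mr : subL s (mr (A ⇛ B) °) ≡ Al* (τ A) (P ⇛ Q) °
  fold-mr = trans (subL-° s (mr (A ⇛ B))) (cong _° (subF-Al* (τ A) s _))

  components : subL s↑ (subL premise ∣ A °∣) ⊸ subL s↑ (subL conclusion ∣ B °∣) ⊣⊢ P ° ⊸ Q °
  components = ⊣⊢-≡ refl (sym (cong₂ _⊸_ (subL-° s↑ _) (subL-° s↑ _)))
    (⊸-cong (∣°∣⊣⊢mr°-renamed A s↑ premise) (∣°∣⊣⊢mr°-renamed B s↑ conclusion))
∣°∣⊣⊢mr° (Al σ A) s = ⊣⊢-≡ (cong (subL s) (∣∀°∣ σ A)) refl
  (!-cong (∀-cong (∣°∣⊣⊢mr°-renamed A (liftS s) _)))
∣°∣⊣⊢mr° (Ex σ A) s = ⊣⊢-≡ (cong (subL s) (∣∃°∣ σ A)) refl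
  (∣°∣⊣⊢mr°-renamed A s _)

theorem4p4 : ∀ {Γ : Ctx} (A : Fm Γ) →
    [] ⊢ (∣ A °∣ ⊸ mr A °) & (mr A ° ⊸ ∣ A °∣)
theorem4p4 A = &R (⊸R (proj₁ equivalence)) (⊸R (proj₂ equivalence))
  where
  equivalence : ∣ A °∣ ⊣⊢ mr A °
  equivalence = ⊣⊢-≡ (sym (subL-id ∣ A °∣)) (sym (subL-id (mr A °))) (∣°∣⊣⊢mr° A var)
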